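{- Let $A \subset \mathbb{Z}$ be a finite set with $\min A = 0$, $\max A = b$, and $\gcd A = 1$. For $v \in \{0, b\}$ let $T_v(A) = \bigcup_{h \geq 0} h(A - v)$ and $\sigma_v(x) = \sum_{a \in T_v(A)} x^a$. Then both $\sigma_0(x)$ and $\sigma_b(x)$ are rational functions of $x$, and for all integers $h \geq 0$ with $h \geq 2b - 4$, \[ \sigma_{hA}(x) = \sigma_0(x) + x^{hb}\,\sigma_b(x), \] where $\sigma_{hA}(x) = \sum_{a \in hA} x^a$.
   Context: For a finite set $B \subset \mathbb{Z}$ and integer $h \geq 0$, $hB = \{b_1 + \cdots + b_h : b_i \in B\}$, with $0B = \{0\}$, and $A - v = \{a - v : a \in A\}$. Note $T_0(A) \subseteq \mathbb{N}$ so $\sigma_0$ is a formal power series in $x$, while $T_b(A) \subseteq -\mathbb{N}$ so $\sigma_b$ is a formal power series in $x^{ -1}$; "rational function" means these series are expansions of rational functions in $x$, and the displayed identity is an identity of rational functions. Here $\mathbb{N} = \{0,1,2,\ldots\}$. -}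

module Defs where

open import Data.Integer
  using (ℤ; +_; -[1+_]; 0ℤ; 1ℤ; _≤_; _<_; _-_; ∣_∣; -≤+; +≤+)
  renaming (_+_ to _+ℤ_; _*_ to _*ℤ_; _≟_ to _≟ℤ_)
open import Data.Integer.GCD using (gcd)
import Data.Integer.Properties as ℤ
open import Data.List
  using (List; []; _∷_; [_]; map; foldr; replicate; _++_; cartesianProductWith; deduplicate)
open import Data.List.Membership.DecPropositional _≟ℤ_ using (_∈?_)
open import Data.List.Membership.Propositional using (_∈_)
open import Data.List.Membership.Propositional.Properties using (∈-cartesianProductWith⁻; ∈-cartesianProductWith⁺)
open import Data.List.Relation.Unary.All as All using (All; []; _∷_)
import Data.List.Relation.Unary.All.Properties as All
open import Data.List.Relation.Unary.Any using (Any; here; there)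
import Data.List.Relation.Unary.Any.Properties as Any
open import Data.Nat as ℕ using (ℕ; zero; suc)
import Data.Nat.Properties as ℕ
open import Data.Product using (∃-syntax; _×_; _,_; proj₂)
open import Data.Sum using (_⊎_; inj₁; inj₂; [_,_]′)
open import Function using (_∘_)
open import Level using (0ℓ)
open import Relation.Binary.PropositionalEquality using (_≡_; _≢_; refl; sym; trans; cong)
open import Relation.Nullary using (Dec; yes; no; does; contradiction)
open import Relation.Nullary.Decidable using (map′)
open import Relation.Unary using (Pred; Decidable)
open import Data.Bool using (if_then_else_)

-- A list of integers stands for the set of its entries: order and
-- repetitions are irrelevant to everything below.

IsMin IsMax : List ℤ → ℤ → Set
IsMin A m = m ∈ A × All (m ≤_) A
IsMax A m = m ∈ A × All (_≤ m) A

setGcd : List ℤ → ℤ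
setGcd = foldr gcd 0ℤ

infixr 8 _·_
_·_ : ℕ → List ℤ → List ℤ
zero  · B = [ 0ℤ ]
suc h · B = cartesianProductWith _+ℤ_ B (h · B)

translate : List ℤ → ℤ → List ℤ
translate A v = map (_- v) A

⋃· : List ℤ → Pred ℤ 0ℓ
⋃· B n = ∃[ h ] n ∈ h · B

T : List ℤ → ℤ → Pred ℤ 0ℓ
T A v = ⋃· (translate A v)

-- T A v is decidable when v is the minimum or the maximum of A: then all
-- elements of A - v have the same sign, and n can only be a sum of
-- elements of A - v if it is a sum of at most ∣ n ∣ of them.

module OneSign
  (P : Pred ℤ 0ℓ) (P-0 : P 0ℤ)
  (P-+ : ∀ {i j} → P i → P j → P (i +ℤ j))
  (∣+∣ : ∀ {i j} → P i → P j → ∣ i +ℤ j ∣ ≡ ∣ i ∣ ℕ.+ ∣ j ∣)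
  {B : List ℤ} (PB : All P B) where

  few : ∀ h {n} → n ∈ h · B → P n × ∃[ k ] (k ℕ.< suc ∣ n ∣ × n ∈ k · B)
  few zero (here refl) = P-0 , 0 , ℕ.≤-refl , here refl
  few (suc h) n∈ with ∈-cartesianProductWith⁻ _+ℤ_ B (h · B) n∈
  ... | i , j , i∈ , j∈ , refl with few h j∈ | All.lookup PB i∈
  ... | Pj , k , k≤j , j∈k | Pi = P-+ Pi Pj , bound (i ≟ℤ 0ℤ)
    where
    bound : Dec (i ≡ 0ℤ) → ∃[ k ] (k ℕ.< suc ∣ i +ℤ j ∣ × i +ℤ j ∈ k · B)
    bound (yes refl) rewrite ℤ.+-identityˡ j = k , k≤j , j∈k
    bound (no i≢0) rewrite ∣+∣ Pi Pj =
      suc k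
      , ℕ.s≤s (ℕ.≤-trans k≤j
          (ℕ.+-monoˡ-≤ ∣ j ∣ (ℕ.n≢0⇒n>0 (i≢0 ∘ ℤ.∣i∣≡0⇒i≡0))))
      , ∈-cartesianProductWith⁺ _+ℤ_ i∈ j∈k

  ⋃·? : Decidable (⋃· B)
  ⋃·? n = map′ (λ (h , _ , n∈) → h , n∈) (λ (h , n∈) → proj₂ (few h n∈))
            (ℕ.anyUpTo? (λ k → n ∈? k · B) (suc ∣ n ∣))

∣+∣-nonNeg : ∀ {i j} → 0ℤ ≤ i → 0ℤ ≤ j → ∣ i +ℤ j ∣ ≡ ∣ i ∣ ℕ.+ ∣ j ∣
∣+∣-nonNeg (+≤+ _) (+≤+ _) = refl

∣+∣-nonPos : ∀ {i j} → i ≤ 0ℤ → j ≤ 0ℤ → ∣ i +ℤ j ∣ ≡ ∣ i ∣ ℕ.+ ∣ j ∣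
∣+∣-nonPos { -[1+ m ]} { -[1+ n ]} -≤+ -≤+ = cong suc (sym (ℕ.+-suc m n))
∣+∣-nonPos { -[1+ m ]} -≤+ (+≤+ ℕ.z≤n) = sym (ℕ.+-identityʳ (suc m))
∣+∣-nonPos {j = j} (+≤+ ℕ.z≤n) _ = cong ∣_∣ (ℤ.+-identityˡ j)

T? : ∀ A v → IsMin A v ⊎ IsMax A v → Decidable (T A v)
T? A v (inj₁ (_ , v≤A)) = OneSign.⋃·? (0ℤ ≤_) ℤ.≤-refl ℤ.+-mono-≤ ∣+∣-nonNeg
  (All.map⁺ (All.map ℤ.i≤j⇒0≤j-i v≤A))
T? A v (inj₂ (_ , A≤v)) = OneSign.⋃·? (_≤ 0ℤ) ℤ.≤-refl ℤ.+-mono-≤ ∣+∣-nonPos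
  (All.map⁺ (All.map ℤ.i≤j⇒i-j≤0 A≤v))

-- f : Series stands for the formal series ∑ₙ f(n) xⁿ, n ∈ ℤ.

Series : Set
Series = ℤ → ℤ

genSeries : {S : Pred ℤ 0ℓ} → Decidable S → Series
genSeries S? n = if does (S? n) then 1ℤ else 0ℤ

σ : ∀ A v → IsMin A v ⊎ IsMax A v → Series
σ A v ext = genSeries (T? A v ext)

-- Polynomials over ℤ: lists of coefficients, constant term first,
-- possibly with trailing zeros.

Poly : Set
Poly = List ℤ

coeff : Poly → ℕ → ℤ
coeff []      n       = 0ℤ
coeff (a ∷ p) zero    = a
coeff (a ∷ p) (suc n) = coeff p n

infix 4 _≈ₚ_
_≈ₚ_ : Poly → Poly → Set
p ≈ₚ q = ∀ n → coeff p n ≡ coeff q n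

infixl 6 _+ₚ_
_+ₚ_ : Poly → Poly → Poly
[]      +ₚ q       = q
(a ∷ p) +ₚ []      = a ∷ p
(a ∷ p) +ₚ (b ∷ q) = (a +ℤ b) ∷ (p +ₚ q)

infixl 7 _*ₚ_
_*ₚ_ : Poly → Poly → Poly
[]      *ₚ q = []
(a ∷ p) *ₚ q = map (a *ℤ_) q +ₚ (0ℤ ∷ p *ₚ q)

NonZeroₚ : Poly → Set
NonZeroₚ = Any (_≢ 0ℤ)

monomial : ℕ → Poly
monomial n = replicate n 0ℤ ++ [ 1ℤ ]

1≢0 : 1ℤ ≢ 0ℤ
1≢0 ()

monomial-nonZero : ∀ n → NonZeroₚ (monomial n)
monomial-nonZero n = Any.++⁺ʳ (replicate n 0ℤ) (here 1≢0)

coeff-+ : ∀ p q n → coeff (p +ₚ q) n ≡ coeff p n +ℤ coeff q n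
coeff-+ []      q       n       = sym (ℤ.+-identityˡ _)
coeff-+ (a ∷ p) []      n       = sym (ℤ.+-identityʳ _)
coeff-+ (a ∷ p) (b ∷ q) zero    = refl
coeff-+ (a ∷ p) (b ∷ q) (suc n) = coeff-+ p q n

coeff-map : ∀ a q n → coeff (map (a *ℤ_) q) n ≡ a *ℤ coeff q n
coeff-map a []      n       = sym (ℤ.*-zeroʳ a)
coeff-map a (b ∷ q) zero    = refl
coeff-map a (b ∷ q) (suc n) = coeff-map a q n

coeff-* : ∀ a p q n →
  coeff ((a ∷ p) *ₚ q) n ≡ a *ℤ coeff q n +ℤ coeff (0ℤ ∷ p *ₚ q) n
coeff-* a p q n = trans (coeff-+ (map (a *ℤ_) q) (0ℤ ∷ p *ₚ q) n)
  (cong (_+ℤ coeff (0ℤ ∷ p *ₚ q) n) (coeff-map a q n))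

coeff-*-shift : ∀ p q n → coeff (p *ₚ (0ℤ ∷ q)) n ≡ coeff (0ℤ ∷ p *ₚ q) n
coeff-*-shift []      q zero    = refl
coeff-*-shift []      q (suc n) = refl
coeff-*-shift (a ∷ p) q zero    =
  trans (coeff-* a p (0ℤ ∷ q) 0) (cong (_+ℤ 0ℤ) (ℤ.*-zeroʳ a))
coeff-*-shift (a ∷ p) q (suc n) =
  trans (coeff-* a p (0ℤ ∷ q) (suc n))
    (trans (cong (a *ℤ coeff q n +ℤ_) (coeff-*-shift p q n))
      (sym (coeff-* a p q n)))

fromCoeff : ∀ p n → coeff p n ≢ 0ℤ → NonZeroₚ p
fromCoeff []      n       ≢0 = contradiction refl ≢0
fromCoeff (a ∷ p) zero    ≢0 = here ≢0
fromCoeff (a ∷ p) (suc n) ≢0 = there (fromCoeff p n ≢0)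

tail-nonZero : ∀ {a p} → a ≡ 0ℤ → NonZeroₚ (a ∷ p) → NonZeroₚ p
tail-nonZero a≡0 (here a≢0)  = contradiction a≡0 a≢0
tail-nonZero a≡0 (there p≢0) = p≢0

nonZeroCoeff : ∀ p q → NonZeroₚ p → NonZeroₚ q → ∃[ n ] coeff (p *ₚ q) n ≢ 0ℤ
nonZeroCoeff [] _ () _
nonZeroCoeff (a ∷ p) q₀ p≢0 q₀≢0 = byHead (a ≟ℤ 0ℤ)
  where
  outer : a ≢ 0ℤ → ∀ q → NonZeroₚ q → ∃[ n ] coeff ((a ∷ p) *ₚ q) n ≢ 0ℤ
  outer a≢0 [] ()
  outer a≢0 (b ∷ q) q≢0 = byHead′ (b ≟ℤ 0ℤ)
    where
    byHead′ : Dec (b ≡ 0ℤ) → ∃[ n ] coeff ((a ∷ p) *ₚ (b ∷ q)) n ≢ 0ℤ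
    byHead′ (no b≢0) =
      0 , [ a≢0 , b≢0 ]′ ∘ ℤ.i*j≡0⇒i≡0∨j≡0 a ∘ trans (sym (ℤ.+-identityʳ (a *ℤ b)))
    byHead′ (yes b≡0) with outer a≢0 q (tail-nonZero b≡0 q≢0)
    ... | n , ≢0 rewrite b≡0 =
      suc n , ≢0 ∘ trans (sym (coeff-*-shift (a ∷ p) q (suc n)))

  byHead : Dec (a ≡ 0ℤ) → ∃[ n ] coeff ((a ∷ p) *ₚ q₀) n ≢ 0ℤ
  byHead (no a≢0) = outer a≢0 q₀ q₀≢0
  byHead (yes a≡0) with nonZeroCoeff p q₀ (tail-nonZero a≡0 p≢0) q₀≢0
  ... | n , ≢0 rewrite a≡0 =
    suc n , ≢0 ∘ trans (sym (trans (coeff-* 0ℤ p q₀ (suc n)) (ℤ.+-identityˡ _)))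

*ₚ-nonZero : ∀ {p q} → NonZeroₚ p → NonZeroₚ q → NonZeroₚ (p *ₚ q)
*ₚ-nonZero {p} {q} p≢0 q≢0 with nonZeroCoeff p q p≢0 q≢0
... | n , ≢0 = fromCoeff (p *ₚ q) n ≢0

-- Rational functions: fractions of integer polynomials, up to
-- cross-multiplication.  This is Frac ℤ[x] = ℚ(x).

record RatFun : Set where
  constructor _/_⟨_⟩
  field
    num         : Poly
    den         : Poly
    den-nonZero : NonZeroₚ den

open RatFun public

infix 4 _≈_
_≈_ : RatFun → RatFun → Set
R ≈ S = num R *ₚ den S ≈ₚ num S *ₚ den R

infixl 6 _+_
_+_ : RatFun → RatFun → RatFun
(p / q ⟨ q≢0 ⟩) + (r / s ⟨ s≢0 ⟩) =
  (p *ₚ s +ₚ r *ₚ q) / (q *ₚ s) ⟨ *ₚ-nonZero q≢0 s≢0 ⟩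

infixl 7 _*_
_*_ : RatFun → RatFun → RatFun
(p / q ⟨ q≢0 ⟩) * (r / s ⟨ s≢0 ⟩) = (p *ₚ r) / (q *ₚ s) ⟨ *ₚ-nonZero q≢0 s≢0 ⟩

0ᴿ : RatFun
0ᴿ = [] / monomial 0 ⟨ monomial-nonZero 0 ⟩

infix 8 x^_
x^_ : ℤ → RatFun
x^ (+ n)    = monomial n / monomial 0 ⟨ monomial-nonZero 0 ⟩
x^ -[1+ n ] = monomial 0 / monomial (suc n) ⟨ monomial-nonZero (suc n) ⟩

-- The sum of xᵃ over the set of entries of the list, so each distinct
-- entry contributes once.
σ-finite : List ℤ → RatFun
σ-finite B = foldr _+_ 0ᴿ (map x^_ (deduplicate _≟ℤ_ B))

infixl 7 _⊛_
_⊛_ : Poly → Series → Series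
([]      ⊛ f) n = 0ℤ
((a ∷ p) ⊛ f) n = a *ℤ f n +ℤ (p ⊛ f) (n - 1ℤ)

toSeries : Poly → Series
toSeries p (+ n)    = coeff p n
toSeries p -[1+ n ] = 0ℤ

-- The support conditions place f in ℤ((x)), respectively ℤ((x⁻¹)).  These
-- embed in the fields ℚ((x)) and ℚ((x⁻¹)), so den · f = num says exactly
-- that f is the expansion of num / den there, and f determines R up to _≈_.
-- (Without them f would not be determined: 1 - x annihilates ∑ₙ xⁿ, n ∈ ℤ.)
_ExpandsAt0To_ _ExpandsAt∞To_ : RatFun → Series → Set
R ExpandsAt0To f =
  (∃[ N ] ∀ n → n < N → f n ≡ 0ℤ) × (∀ n → (den R ⊛ f) n ≡ toSeries (num R) n)
R ExpandsAt∞To f =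
  (∃[ N ] ∀ n → N < n → f n ≡ 0ℤ) × (∀ n → (den R ⊛ f) n ≡ toSeries (num R) n)

{-# OPTIONS --safe #-}
module Submission where

open import Defs
open import Data.Integer using (ℤ; +_; 0ℤ; 1ℤ; _≤_; _-_) renaming (_*_ to _*ℤ_)
open import Data.List using (List)
open import Data.Nat using (ℕ)
open import Data.Product using (_×_; ∃-syntax)
open import Data.Sum using (inj₁; inj₂)
open import Relation.Binary.PropositionalEquality using (_≡_)

import Data.Integer.Properties as ℤ
open import Algebra.Properties.AbelianGroup ℤ.+-0-abelianGroup
  using () renaming (∙-cancelʳ to +-cancelʳ)
open import Data.Fin using (Fin; toℕ; fromℕ<)
import Data.Fin.Properties as Fin
open import Data.Integer using (-[1+_]; -_; ∣_∣; _<_; +≤+; -<+; +<+; nonNegative)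
  renaming (_+_ to _+ℤ_; _≟_ to _≟ℤ_)
open import Data.Integer.DivMod using (_%ℕ_; _/ℕ_; n%ℕd<d; a≡a%ℕn+[a/ℕn]*n)
open import Data.Integer.Tactic.RingSolver using (solve-∀)
open import Data.List using ([]; _∷_; [_]; map; foldr; deduplicate; applyUpTo)
open import Data.List.Membership.Propositional using (_∈_; _∉_)
open import Data.List.Membership.Propositional.Properties
  using (∈-cartesianProductWith⁺; ∈-cartesianProductWith⁻; ∈-map⁺; ∈-map⁻;
         ∈-deduplicate⁺; ∈-deduplicate⁻)
open import Data.List.Relation.Unary.All as All using (All; []; _∷_)
import Data.List.Relation.Unary.All.Properties as All
open import Data.List.Relation.Unary.AllPairs using (_∷_)
open import Data.List.Relation.Unary.Any using (here; there)
open import Data.List.Relation.Unary.Unique.DecPropositional.Properties _≟ℤ_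
  using (deduplicate-!)
open import Data.List.Relation.Unary.Unique.Propositional using (Unique)
open import Data.Nat using (zero; suc)
import Data.Nat as ℕ
import Data.Nat.GCD as ℕ
open import Data.Nat.Induction using (<-rec)
import Data.Nat.Properties as ℕ
open import Data.Nat.Tactic.RingSolver using () renaming (solve-∀ to ℕ-solve-∀)
open import Data.Product using (_,_; proj₁; proj₂; Σ-syntax)
open import Data.Sum using (_⊎_; [_,_]′)
open import Function using (_∘_)
open import Level using (0ℓ)
open import Relation.Binary.PropositionalEquality
  using (_≢_; refl; sym; trans; cong; cong₂; subst; module ≡-Reasoning)
open import Relation.Nullary using (¬_; yes; no; contradiction)
open import Relation.Nullary.Decidable using (dec-true; dec-false)
open import Relation.Unary using (Pred; Decidable)

-- Write n ∈ T₀ as a sum of elements of A.  By the pigeonhole principle any b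
-- summands contain a block whose sum is divisible by b, so n = s + jb with s a
-- sum of at most b - 1 elements of A (exactly b - 1, as 0 ∈ A) and j ≥ 0;
-- likewise n - hb = s′ - ib if n - hb ∈ T_b.  If neither b - 1 + j ≤ h nor
-- b - 1 + i ≤ h, then h ≥ 2b - 4 gives i + j ≥ h, and hb = s - s′ + (i + j)b
-- forces s = s′ = 0, so n = jb with j ≤ h.  Thus n ∈ hA as soon as n ∈ T₀ and
-- n - hb ∈ T_b.  As gcd A = 1, sums of b - 1 elements of A meet every residue
-- class mod b, whence every integer n satisfies n ∈ T₀ or n - hb ∈ T_b.
-- Therefore [n ∈ T₀] + [n - hb ∈ T_b] = [n ∈ hA] + 1 for all n ∈ ℤ, and 1 - x
-- annihilates the extra term ∑ₙ xⁿ.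

-- Series represented by rational functions

infix 4 _≗ˢ_
_≗ˢ_ : Series → Series → Set
f ≗ˢ g = ∀ n → f n ≡ g n

infixl 6 _⊕_
_⊕_ : Series → Series → Series
(f ⊕ g) n = f n +ℤ g n

shift : ℤ → Series → Series
shift k f n = f (n - k)

⊛-cong : ∀ p {f g} → f ≗ˢ g → p ⊛ f ≗ˢ p ⊛ g
⊛-cong []      f≗g n = refl
⊛-cong (a ∷ p) f≗g n = cong₂ _+ℤ_ (cong (a *ℤ_) (f≗g n)) (⊛-cong p f≗g (n - 1ℤ))

⊛-distribˡ-⊕ : ∀ p f g → p ⊛ (f ⊕ g) ≗ˢ p ⊛ f ⊕ p ⊛ g
⊛-distribˡ-⊕ []      f g n = refl
⊛-distribˡ-⊕ (a ∷ p) f g n rewrite ⊛-distribˡ-⊕ p f g (n - 1ℤ) =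
  lemma a (f n) (g n) ((p ⊛ f) (n - 1ℤ)) ((p ⊛ g) (n - 1ℤ))
  where
  lemma : ∀ a x y u v → a *ℤ (x +ℤ y) +ℤ (u +ℤ v) ≡ a *ℤ x +ℤ u +ℤ (a *ℤ y +ℤ v)
  lemma = solve-∀

⊛-scale : ∀ p a f → p ⊛ (λ n → a *ℤ f n) ≗ˢ λ n → a *ℤ (p ⊛ f) n
⊛-scale []      a f n = sym (ℤ.*-zeroʳ a)
⊛-scale (c ∷ p) a f n rewrite ⊛-scale p a f (n - 1ℤ) =
  lemma c a (f n) ((p ⊛ f) (n - 1ℤ))
  where
  lemma : ∀ c a x u → c *ℤ (a *ℤ x) +ℤ a *ℤ u ≡ a *ℤ (c *ℤ x +ℤ u)
  lemma = solve-∀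

⊛-shift : ∀ p k f → p ⊛ shift k f ≗ˢ shift k (p ⊛ f)
⊛-shift []      k f n = refl
⊛-shift (a ∷ p) k f n rewrite ⊛-shift p k f (n - 1ℤ) =
  cong (λ m → a *ℤ f (n - k) +ℤ (p ⊛ f) m) (lemma n k)
  where
  lemma : ∀ n k → n - 1ℤ - k ≡ n - k - 1ℤ
  lemma = solve-∀

+ₚ-⊛ : ∀ p q f → (p +ₚ q) ⊛ f ≗ˢ p ⊛ f ⊕ q ⊛ f
+ₚ-⊛ []      q       f n = sym (ℤ.+-identityˡ _)
+ₚ-⊛ (a ∷ p) []      f n = sym (ℤ.+-identityʳ _)
+ₚ-⊛ (a ∷ p) (b ∷ q) f n rewrite +ₚ-⊛ p q f (n - 1ℤ) =
  lemma a b (f n) ((p ⊛ f) (n - 1ℤ)) ((q ⊛ f) (n - 1ℤ))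
  where
  lemma : ∀ a b x u v → (a +ℤ b) *ℤ x +ℤ (u +ℤ v) ≡ a *ℤ x +ℤ u +ℤ (b *ℤ x +ℤ v)
  lemma = solve-∀

map-⊛ : ∀ a q f → map (a *ℤ_) q ⊛ f ≗ˢ λ n → a *ℤ (q ⊛ f) n
map-⊛ a []      f n = sym (ℤ.*-zeroʳ a)
map-⊛ a (b ∷ q) f n rewrite map-⊛ a q f (n - 1ℤ) =
  lemma a b (f n) ((q ⊛ f) (n - 1ℤ))
  where
  lemma : ∀ a b x u → a *ℤ b *ℤ x +ℤ a *ℤ u ≡ a *ℤ (b *ℤ x +ℤ u)
  lemma = solve-∀

*ₚ-⊛ : ∀ p q f → (p *ₚ q) ⊛ f ≗ˢ p ⊛ (q ⊛ f)
*ₚ-⊛ []      q f n = refl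
*ₚ-⊛ (a ∷ p) q f n = trans (+ₚ-⊛ (map (a *ℤ_) q) (0ℤ ∷ p *ₚ q) f n)
  (cong₂ _+ℤ_ (map-⊛ a q f n)
    (trans (ℤ.+-identityˡ _) (*ₚ-⊛ p q f (n - 1ℤ))))

⊛-zero : ∀ p → p ⊛ (λ _ → 0ℤ) ≗ˢ λ _ → 0ℤ
⊛-zero []      n = refl
⊛-zero (a ∷ p) n rewrite ⊛-zero p (n - 1ℤ) = trans (ℤ.+-identityʳ _) (ℤ.*-zeroʳ a)

-- `(a ∷ p) ⊛_` is built from scaling and the unit shift, and `q ⊛_` commutes with both.
⊛-comm : ∀ p q f → p ⊛ (q ⊛ f) ≗ˢ q ⊛ (p ⊛ f)
⊛-comm [] q f n = sym (⊛-zero q n)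
⊛-comm (a ∷ p) q f n = begin
  a *ℤ (q ⊛ f) n +ℤ (p ⊛ (q ⊛ f)) (n - 1ℤ)
    ≡⟨ cong₂ _+ℤ_ (sym (⊛-scale q a f n)) (⊛-comm p q f (n - 1ℤ)) ⟩
  (q ⊛ (λ m → a *ℤ f m)) n +ℤ (q ⊛ (p ⊛ f)) (n - 1ℤ)
    ≡⟨ cong ((q ⊛ (λ m → a *ℤ f m)) n +ℤ_) (⊛-shift q 1ℤ (p ⊛ f) n) ⟨
  (q ⊛ (λ m → a *ℤ f m)) n +ℤ (q ⊛ shift 1ℤ (p ⊛ f)) n
    ≡⟨ ⊛-distribˡ-⊕ q _ _ n ⟨
  (q ⊛ ((a ∷ p) ⊛ f)) n ∎
  where open ≡-Reasoning

δ : Series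
δ = toSeries [ 1ℤ ]

-- `δ` is the series 1. Writing polynomials as their action on `δ` reduces identities between
-- products of coefficient lists to `*ₚ-⊛` and `⊛-comm`.
toSeries-⊛ : ∀ p → toSeries p ≗ˢ p ⊛ δ
toSeries-⊛ []      (+ n)        = refl
toSeries-⊛ []      -[1+ n ]     = refl
toSeries-⊛ (a ∷ p) (+ zero)     rewrite sym (toSeries-⊛ p -[1+ 0 ]) =
  sym (trans (ℤ.+-identityʳ _) (ℤ.*-identityʳ a))
toSeries-⊛ (a ∷ p) (+ (suc n))  rewrite sym (toSeries-⊛ p (+ n)) =
  sym (trans (cong (_+ℤ coeff p n) (ℤ.*-zeroʳ a)) (ℤ.+-identityˡ _))
toSeries-⊛ (a ∷ p) -[1+ n ]     rewrite sym (toSeries-⊛ p (-[1+ n ] - 1ℤ)) =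
  sym (trans (ℤ.+-identityʳ _) (ℤ.*-zeroʳ a))

toSeries-* : ∀ p q → toSeries (p *ₚ q) ≗ˢ p ⊛ toSeries q
toSeries-* p q n = trans (toSeries-⊛ (p *ₚ q) n)
  (trans (*ₚ-⊛ p q δ n) (⊛-cong p (λ m → sym (toSeries-⊛ q m)) n))

toSeries-+ : ∀ p q → toSeries (p +ₚ q) ≗ˢ toSeries p ⊕ toSeries q
toSeries-+ p q (+ n)    = coeff-+ p q n
toSeries-+ p q -[1+ n ] = refl

-- No support condition: two series represented by the same rational function
-- may differ by a torsion element, that is one annihilated by a polynomial.
infix 4 _Represents_
_Represents_ : RatFun → Series → Set
R Represents f = den R ⊛ f ≗ˢ toSeries (num R)

-- Both cross products, read as series, equal `den R ⊛ (den S ⊛ f)`.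
represents-unique : ∀ {R S f} → R Represents f → S Represents f → R ≈ S
represents-unique {R} {S} {f} Rf Sf n = begin
  toSeries (num R *ₚ den S) (+ n)  ≡⟨ cross R S Rf ⟩
  (den R ⊛ (den S ⊛ f)) (+ n)      ≡⟨ ⊛-comm (den R) (den S) f (+ n) ⟩
  (den S ⊛ (den R ⊛ f)) (+ n)      ≡⟨ cross S R Sf ⟨
  toSeries (num S *ₚ den R) (+ n)  ∎
  where
  open ≡-Reasoning
  cross : ∀ R S → R Represents f →
    toSeries (num R *ₚ den S) (+ n) ≡ (den R ⊛ (den S ⊛ f)) (+ n)
  cross R S Rf = begin
    toSeries (num R *ₚ den S) (+ n)      ≡⟨ toSeries-⊛ (num R *ₚ den S) (+ n) ⟩
    ((num R *ₚ den S) ⊛ δ) (+ n)         ≡⟨ *ₚ-⊛ (num R) (den S) δ (+ n) ⟩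
    (num R ⊛ (den S ⊛ δ)) (+ n)          ≡⟨ ⊛-comm (num R) (den S) δ (+ n) ⟩
    (den S ⊛ (num R ⊛ δ)) (+ n)          ≡⟨ ⊛-cong (den S) (λ m → trans (sym (toSeries-⊛ (num R) m)) (sym (Rf m))) (+ n) ⟩
    (den S ⊛ (den R ⊛ f)) (+ n)          ≡⟨ ⊛-comm (den S) (den R) f (+ n) ⟩
    (den R ⊛ (den S ⊛ f)) (+ n)          ∎

represents-cong : ∀ {R f g} → f ≗ˢ g → R Represents f → R Represents g
represents-cong {R} f≗g Rf n = trans (sym (⊛-cong (den R) f≗g n)) (Rf n)

-- This discards the two-sided series ∑ₙ xⁿ that is left over when the expansions at 0 and at
-- infinity are added.
represents-torsion : ∀ {R f g} → den R ⊛ g ≗ˢ (λ _ → 0ℤ) → R Represents f ⊕ g → R Represents f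
represents-torsion {R} {f} {g} g0 Rfg n = begin
  (den R ⊛ f) n                      ≡⟨ ℤ.+-identityʳ _ ⟨
  (den R ⊛ f) n +ℤ 0ℤ                ≡⟨ cong ((den R ⊛ f) n +ℤ_) (g0 n) ⟨
  (den R ⊛ f) n +ℤ (den R ⊛ g) n     ≡⟨ ⊛-distribˡ-⊕ (den R) f g n ⟨
  (den R ⊛ (f ⊕ g)) n                ≡⟨ Rfg n ⟩
  toSeries (num R) n                 ∎
  where open ≡-Reasoning

+-represents : ∀ {R S f g} → R Represents f → S Represents g → R + S Represents f ⊕ g
+-represents {R} {S} {f} {g} Rf Sg n = begin
  ((den R *ₚ den S) ⊛ (f ⊕ g)) n
    ≡⟨ *ₚ-⊛ (den R) (den S) (f ⊕ g) n ⟩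
  (den R ⊛ (den S ⊛ (f ⊕ g))) n
    ≡⟨ ⊛-cong (den R) (⊛-distribˡ-⊕ (den S) f g) n ⟩
  (den R ⊛ (den S ⊛ f ⊕ den S ⊛ g)) n
    ≡⟨ ⊛-distribˡ-⊕ (den R) (den S ⊛ f) (den S ⊛ g) n ⟩
  (den R ⊛ (den S ⊛ f)) n +ℤ (den R ⊛ (den S ⊛ g)) n
    ≡⟨ cong₂ _+ℤ_ (trans (⊛-comm (den R) (den S) f n) (⊛-cong (den S) Rf n)) (⊛-cong (den R) Sg n) ⟩
  (den S ⊛ toSeries (num R)) n +ℤ (den R ⊛ toSeries (num S)) n
    ≡⟨ cong₂ _+ℤ_ (swap (num R) (den S)) (swap (num S) (den R)) ⟩
  toSeries (num R *ₚ den S) n +ℤ toSeries (num S *ₚ den R) n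
    ≡⟨ toSeries-+ (num R *ₚ den S) (num S *ₚ den R) n ⟨
  toSeries (num R *ₚ den S +ₚ num S *ₚ den R) n ∎
  where
  open ≡-Reasoning
  swap : ∀ p q → (q ⊛ toSeries p) n ≡ toSeries (p *ₚ q) n
  swap p q = begin
    (q ⊛ toSeries p) n     ≡⟨ ⊛-cong q (toSeries-⊛ p) n ⟩
    (q ⊛ (p ⊛ δ)) n        ≡⟨ ⊛-comm q p δ n ⟩
    (p ⊛ (q ⊛ δ)) n        ≡⟨ *ₚ-⊛ p q δ n ⟨
    ((p *ₚ q) ⊛ δ) n       ≡⟨ toSeries-⊛ (p *ₚ q) n ⟨
    toSeries (p *ₚ q) n    ∎

monomial-⊛ : ∀ k f → monomial k ⊛ f ≗ˢ shift (+ k) f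
monomial-⊛ zero    f n = trans (ℤ.+-identityʳ _) (trans (ℤ.*-identityˡ (f n)) (cong f (sym (ℤ.+-identityʳ n))))
monomial-⊛ (suc k) f n = trans (ℤ.+-identityˡ _)
  (trans (monomial-⊛ k f (n - 1ℤ)) (cong f (lemma n (+ k))))
  where
  lemma : ∀ n k → n - 1ℤ - k ≡ n - (1ℤ +ℤ k)
  lemma = solve-∀

toSeries-monomial : ∀ k → toSeries (monomial k) ≗ˢ shift (+ k) δ
toSeries-monomial k n = trans (toSeries-⊛ (monomial k) n) (monomial-⊛ k δ n)

x^*-represents : ∀ m {R f} → R Represents f → x^ (+ m) * R Represents shift (+ m) f
x^*-represents m {R} {f} Rf n = begin
  ((monomial 0 *ₚ den R) ⊛ shift (+ m) f) n    ≡⟨ *ₚ-⊛ (monomial 0) (den R) (shift (+ m) f) n ⟩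
  (monomial 0 ⊛ (den R ⊛ shift (+ m) f)) n     ≡⟨ monomial-⊛ 0 (den R ⊛ shift (+ m) f) n ⟩
  (den R ⊛ shift (+ m) f) (n - 0ℤ)             ≡⟨ cong (den R ⊛ shift (+ m) f) (ℤ.+-identityʳ n) ⟩
  (den R ⊛ shift (+ m) f) n                    ≡⟨ ⊛-shift (den R) (+ m) f n ⟩
  (den R ⊛ f) (n - + m)                        ≡⟨ Rf (n - + m) ⟩
  toSeries (num R) (n - + m)                   ≡⟨ monomial-⊛ m (toSeries (num R)) n ⟨
  (monomial m ⊛ toSeries (num R)) n            ≡⟨ toSeries-* (monomial m) (num R) n ⟨
  toSeries (monomial m *ₚ num R) n             ∎
  where open ≡-Reasoning

x^-represents : ∀ i → x^ i Represents shift i δ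
x^-represents (+ k) n = trans (monomial-⊛ 0 (shift (+ k) δ) n)
  (trans (cong (shift (+ k) δ) (ℤ.+-identityʳ n)) (sym (toSeries-monomial k n)))
x^-represents -[1+ k ] n = trans (monomial-⊛ (suc k) (shift -[1+ k ] δ) n)
  (cong δ (lemma n (+ suc k)))
  where
  lemma : ∀ n k → n - k +ℤ k ≡ n
  lemma = solve-∀

-- Generating functions of finite sets

-- The Laurent polynomial ∑ xⁱ over the list, as a series. On a list without repetitions it is the
-- indicator of membership.
multiplicity : List ℤ → Series
multiplicity []       n = 0ℤ
multiplicity (i ∷ is) n = shift i δ n +ℤ multiplicity is n

sum-represents : ∀ is → foldr _+_ 0ᴿ (map x^_ is) Represents multiplicity is
sum-represents []       n = trans (monomial-⊛ 0 (λ _ → 0ℤ) n) (sym (toSeries-⊛ [] n))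
sum-represents (i ∷ is) = +-represents {x^ i} {foldr _+_ 0ᴿ (map x^_ is)}
  (x^-represents i) (sum-represents is)

δ-self : ∀ n → shift n δ n ≡ 1ℤ
δ-self n = cong δ (ℤ.+-inverseʳ n)

δ-other : ∀ {i n} → n ≢ i → shift i δ n ≡ 0ℤ
δ-other {i} {n} n≢i with n - i in eq
... | + zero    = contradiction (ℤ.i-j≡0⇒i≡j n i eq) n≢i
... | + (suc _) = refl
... | -[1+ _ ]  = refl

multiplicity-∉ : ∀ is {n} → n ∉ is → multiplicity is n ≡ 0ℤ
multiplicity-∉ []       n∉ = refl
multiplicity-∉ (i ∷ is) n∉ = cong₂ _+ℤ_ (δ-other (n∉ ∘ here)) (multiplicity-∉ is (n∉ ∘ there))

multiplicity-∈ : ∀ {is n} → Unique is → n ∈ is → multiplicity is n ≡ 1ℤ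
multiplicity-∈ {i ∷ is} (i≢ ∷ _) (here refl) =
  cong₂ _+ℤ_ (δ-self i) (multiplicity-∉ is λ i∈ → All.lookup i≢ i∈ refl)
multiplicity-∈ {i ∷ is} {n} (i≢ ∷ u) (there n∈) =
  cong₂ _+ℤ_ (δ-other {i} {n} (λ n≡i → All.lookup i≢ n∈ (sym n≡i))) (multiplicity-∈ u n∈)

σ-finite-represents : ∀ B → σ-finite B Represents multiplicity (deduplicate _≟ℤ_ B)
σ-finite-represents B = sum-represents (deduplicate _≟ℤ_ B)

-- Rationality of eventually constant series

finiteSupport⇒polynomial : ∀ f N → (∀ n → n < 0ℤ → f n ≡ 0ℤ) → (∀ n → + N ≤ n → f n ≡ 0ℤ) →
  toSeries (applyUpTo (f ∘ +_) N) ≗ˢ f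
finiteSupport⇒polynomial f N below above (+ n) = coefficients (f ∘ +_) N n (λ m N≤m → above (+ m) (+≤+ N≤m))
  where
  coefficients : ∀ (g : ℕ → ℤ) N n → (∀ m → N ℕ.≤ m → g m ≡ 0ℤ) → coeff (applyUpTo g N) n ≡ g n
  coefficients g zero    n       g0 = sym (g0 n ℕ.z≤n)
  coefficients g (suc N) zero    g0 = refl
  coefficients g (suc N) (suc n) g0 = coefficients (g ∘ suc) N n (λ m N≤m → g0 (suc m) (ℕ.s≤s N≤m))
finiteSupport⇒polynomial f N below above -[1+ n ] = sym (below -[1+ n ] -<+)

1-x : Poly
1-x = 1ℤ ∷ -[1+ 0 ] ∷ []

1-x-⊛ : ∀ f n → (1-x ⊛ f) n ≡ f n - f (n - 1ℤ)
1-x-⊛ f n = lemma (f n) (f (n - 1ℤ))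
  where
  lemma : ∀ x y → 1ℤ *ℤ x +ℤ (-[1+ 0 ] *ℤ y +ℤ 0ℤ) ≡ x - y
  lemma = solve-∀

1-x-nonZero : NonZeroₚ 1-x
1-x-nonZero = here 1≢0

monomial*1-x-nonZero : ∀ N → NonZeroₚ (monomial N *ₚ 1-x)
monomial*1-x-nonZero N = *ₚ-nonZero (monomial-nonZero N) 1-x-nonZero

-- The factor `1-x` commutes past `q` and turns a constant series into differences of equal terms.
-- The product has the form of the denominator of a sum whose first summand has denominator `1-x`.
1-x-torsion : ∀ q {c} → (1-x *ₚ q) ⊛ (λ _ → c) ≗ˢ λ _ → 0ℤ
1-x-torsion q {c} n = begin
  ((1-x *ₚ q) ⊛ (λ _ → c)) n     ≡⟨ *ₚ-⊛ 1-x q (λ _ → c) n ⟩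
  (1-x ⊛ (q ⊛ (λ _ → c))) n      ≡⟨ ⊛-comm 1-x q (λ _ → c) n ⟩
  (q ⊛ (1-x ⊛ (λ _ → c))) n      ≡⟨ ⊛-cong q (λ m → trans (1-x-⊛ (λ _ → c) m) (ℤ.+-inverseʳ c)) n ⟩
  (q ⊛ (λ _ → 0ℤ)) n             ≡⟨ ⊛-zero q n ⟩
  0ℤ                             ∎
  where open ≡-Reasoning

eventuallyConstant⇒rational₀ : ∀ {f} {c : ℤ} N → (∀ n → n < 0ℤ → f n ≡ 0ℤ) → (∀ n → + N ≤ n → f n ≡ c) →
  ∃[ p ] (p / 1-x ⟨ 1-x-nonZero ⟩) ExpandsAt0To f
eventuallyConstant⇒rational₀ {f} N below above =
  -- The numerator is (1 - x)f. Its coefficient at `N` may still be nonzero, as f may jump between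
  -- `N - 1` and `N`; hence `suc N` coefficients.
  applyUpTo (d ∘ +_) (suc N) , (0ℤ , below)
  , λ n → trans (1-x-⊛ f n) (sym (finiteSupport⇒polynomial d (suc N) d-below d-above n))
  where
  d : Series
  d n = f n - f (n - 1ℤ)
  d-below : ∀ n → n < 0ℤ → d n ≡ 0ℤ
  d-below n n<0 = cong₂ _-_ (below n n<0) (below (n - 1ℤ) (ℤ.≤-<-trans (ℤ.i-j≤i n 1ℤ) n<0))
  d-above : ∀ n → + suc N ≤ n → d n ≡ 0ℤ
  d-above n N<n = ℤ.i≡j⇒i-j≡0 (trans (above n (ℤ.≤-trans (+≤+ (ℕ.n≤1+n N)) N<n))
    (sym (above (n - 1ℤ) (ℤ.+-monoˡ-≤ (- 1ℤ) N<n))))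

eventuallyConstant⇒rational∞ : ∀ {f} {c : ℤ} N → (∀ n → 0ℤ < n → f n ≡ 0ℤ) → (∀ n → n ≤ - + N → f n ≡ c) →
  ∃[ p ] (p / monomial N *ₚ 1-x ⟨ monomial*1-x-nonZero N ⟩) ExpandsAt∞To f
eventuallyConstant⇒rational∞ {f} N above below =
  -- The factor `monomial N` in the denominator moves the support of (1 - x)f to nonnegative
  -- exponents. The last difference that may be nonzero is f(1) - f(0), which lands at exponent
  -- `N + 1`.
  applyUpTo (d ∘ +_) (2 ℕ.+ N) , (0ℤ , above)
  , λ n → trans (expand n) (sym (finiteSupport⇒polynomial d (2 ℕ.+ N) d-below d-above n))
  where
  d : Series
  d n = f (n - + N) - f (n - + N - 1ℤ)
  expand : ∀ n → ((monomial N *ₚ 1-x) ⊛ f) n ≡ d n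
  expand n = trans (*ₚ-⊛ (monomial N) 1-x f n)
    (trans (monomial-⊛ N (1-x ⊛ f) n) (1-x-⊛ f (n - + N)))
  d-below : ∀ n → n < 0ℤ → d n ≡ 0ℤ
  d-below n n<0 = ℤ.i≡j⇒i-j≡0 (trans (below _ n-N≤-N)
    (sym (below _ (ℤ.≤-trans (ℤ.i-j≤i _ 1ℤ) n-N≤-N))))
    where
    n-N≤-N : n - + N ≤ - + N
    n-N≤-N = subst (n - + N ≤_) (ℤ.+-identityˡ _) (ℤ.+-monoˡ-≤ (- + N) (ℤ.<⇒≤ n<0))
  d-above : ∀ n → + (2 ℕ.+ N) ≤ n → d n ≡ 0ℤ
  d-above n N≤n = cong₂ _-_ (above _ (ℤ.<-≤-trans 0<n-N-1 (ℤ.i-j≤i _ 1ℤ))) (above _ 0<n-N-1)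
    where
    lemma : ∀ N → + 2 +ℤ N - N - 1ℤ ≡ 1ℤ
    lemma = solve-∀
    0<n-N-1 : 0ℤ < n - + N - 1ℤ
    0<n-N-1 = ℤ.<-≤-trans (+<+ (ℕ.s≤s ℕ.z≤n))
      (subst (_≤ n - + N - 1ℤ) (lemma (+ N)) (ℤ.+-monoˡ-≤ (- 1ℤ) (ℤ.+-monoˡ-≤ (- + N) N≤n)))

-- Sumsets

·-closed : {P : Pred ℤ 0ℓ} → P 0ℤ → (∀ {i j} → P i → P j → P (i +ℤ j)) →
  ∀ {B} → All P B → ∀ h {n} → n ∈ h · B → P n
·-closed P0 P+ PB zero    (here refl) = P0
·-closed P0 P+ {B} PB (suc h) n∈ with ∈-cartesianProductWith⁻ _+ℤ_ B (h · B) n∈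
... | _ , _ , i∈ , j∈ , refl = P+ (All.lookup PB i∈) (·-closed P0 P+ PB h j∈)

·-+ : ∀ {B} h k {m n} → m ∈ h · B → n ∈ k · B → m +ℤ n ∈ (h ℕ.+ k) · B
·-+ {B} zero k {n = n} (here refl) n∈ = subst (_∈ k · B) (sym (ℤ.+-identityˡ n)) n∈
·-+ {B} (suc h) k {n = n} m∈ n∈ with ∈-cartesianProductWith⁻ _+ℤ_ B (h · B) m∈
... | i , j , i∈ , j∈ , refl = subst (_∈ suc (h ℕ.+ k) · B) (sym (ℤ.+-assoc i j n))
  (∈-cartesianProductWith⁺ _+ℤ_ i∈ (·-+ h k j∈ n∈))

·-multiple : ∀ {B} k {i} → i ∈ B → + k *ℤ i ∈ k · B
·-multiple zero {i} i∈ = here refl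
·-multiple {B} (suc k) {i} i∈ = subst (_∈ suc k · B) (lemma (+ k) i)
  (∈-cartesianProductWith⁺ _+ℤ_ i∈ (·-multiple k i∈))
  where
  lemma : ∀ k i → i +ℤ k *ℤ i ≡ (1ℤ +ℤ k) *ℤ i
  lemma = solve-∀

·-mono-≤ : ∀ {B} → 0ℤ ∈ B → ∀ {h k} → h ℕ.≤ k → ∀ {n} → n ∈ h · B → n ∈ k · B
·-mono-≤ {B} 0∈ {h} {k} h≤k {n} n∈ = subst (λ l → n ∈ l · B) (ℕ.m∸n+n≡m h≤k)
  (subst (_∈ (k ℕ.∸ h ℕ.+ h) · B) (lemma (+ (k ℕ.∸ h)) n) (·-+ (k ℕ.∸ h) h (·-multiple (k ℕ.∸ h) 0∈) n∈))
  where
  lemma : ∀ k n → k *ℤ 0ℤ +ℤ n ≡ n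
  lemma = solve-∀

·-translate⁺ : ∀ {A} v h {n} → n ∈ h · A → n - + h *ℤ v ∈ h · translate A v
·-translate⁺ v zero    (here refl) = here refl
·-translate⁺ {A} v (suc h) n∈ with ∈-cartesianProductWith⁻ _+ℤ_ A (h · A) n∈
... | i , j , i∈ , j∈ , refl = subst (_∈ suc h · translate A v) (lemma i j v (+ h))
  (∈-cartesianProductWith⁺ _+ℤ_ (∈-map⁺ (_- v) i∈) (·-translate⁺ v h j∈))
  where
  lemma : ∀ i j v h → i - v +ℤ (j - h *ℤ v) ≡ i +ℤ j - (1ℤ +ℤ h) *ℤ v
  lemma = solve-∀

·-translate⁻ : ∀ {A} v h {n} → n ∈ h · translate A v → n +ℤ + h *ℤ v ∈ h · A
·-translate⁻ v zero    (here refl) = here refl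
·-translate⁻ {A} v (suc h) n∈ with ∈-cartesianProductWith⁻ _+ℤ_ (translate A v) (h · translate A v) n∈
... | _ , j , i-v∈ , j∈ , refl with ∈-map⁻ (_- v) i-v∈
...   | i , i∈ , refl = subst (_∈ suc h · A) (lemma i j v (+ h))
  (∈-cartesianProductWith⁺ _+ℤ_ i∈ (·-translate⁻ v h j∈))
  where
  lemma : ∀ i j v h → i +ℤ (j +ℤ h *ℤ v) ≡ i - v +ℤ j +ℤ (1ℤ +ℤ h) *ℤ v
  lemma = solve-∀

-- Reduction of sums modulo b

-- Stated for any `B` containing 0, with `suc β` only as a modulus, so that it applies both to `A`
-- and to `translate A b`.
module Reduction {B : List ℤ} (0∈B : 0ℤ ∈ B) (β : ℕ) where

  b : ℤ
  b = + suc β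

  -- `p i` is the sum of the first `i` summands of `n`, constant from `h` on. Past `h` the summands
  -- count as 0, which lies in `B`, so differences of `p` are sums of elements of `B` for all `i`
  -- and `d`.
  partialSums : ∀ h {n} → n ∈ h · B →
    Σ[ p ∈ (ℕ → ℤ) ] p 0 ≡ 0ℤ × p h ≡ n × (∀ i d → p (i ℕ.+ d) - p i ∈ d · B)
  partialSums zero (here refl) = (λ _ → 0ℤ) , refl , refl , λ i d → ·-mono-≤ 0∈B {0} {d} ℕ.z≤n (here refl)
  partialSums (suc h) n∈ with ∈-cartesianProductWith⁻ _+ℤ_ B (h · B) n∈
  ... | a , m , a∈ , m∈ , refl with partialSums h m∈
  ...   | p , p0≡0 , ph≡m , steps = p′ , refl , cong (a +ℤ_) ph≡m , steps′
    where
    p′ : ℕ → ℤ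
    p′ zero    = 0ℤ
    p′ (suc i) = a +ℤ p i

    head : ∀ a x → a +ℤ (x - 0ℤ) ≡ a +ℤ x - 0ℤ
    head = solve-∀
    cancel : ∀ a x y → x - y ≡ a +ℤ x - (a +ℤ y)
    cancel = solve-∀

    steps′ : ∀ i d → p′ (i ℕ.+ d) - p′ i ∈ d · B
    steps′ zero    zero    = here refl
    steps′ zero    (suc d) = subst (_∈ suc d · B) (head a (p d))
      (∈-cartesianProductWith⁺ _+ℤ_ a∈ (subst (λ z → p d - z ∈ d · B) p0≡0 (steps 0 d)))
    steps′ (suc i) d       = subst (_∈ d · B) (cancel a (p (i ℕ.+ d)) (p i)) (steps i d)

-- Abstract so that with-abstraction does not unfold the pigeonhole search.
  abstract
    repeatedResidue : ∀ (p : ℕ → ℤ) → ∃[ i ] ∃[ j ] i ℕ.< j × j ℕ.≤ suc β × ∃[ q ] p j - p i ≡ q *ℤ b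
    repeatedResidue p with Fin.pigeonhole (ℕ.n<1+n (suc β)) residue
      where
      residue : Fin (suc (suc β)) → Fin (suc β)
      residue i = fromℕ< (n%ℕd<d (p (toℕ i)) (suc β))
    ... | i , j , i<j , ri≡rj = toℕ i , toℕ j , i<j , Fin.toℕ≤pred[n] j , pj /ℕ suc β - pi /ℕ suc β , (begin
      pj - pi
        ≡⟨ cong₂ _-_ (a≡a%ℕn+[a/ℕn]*n pj (suc β)) (a≡a%ℕn+[a/ℕn]*n pi (suc β)) ⟩
      + (pj %ℕ suc β) +ℤ pj /ℕ suc β *ℤ b - (+ (pi %ℕ suc β) +ℤ pi /ℕ suc β *ℤ b)
        ≡⟨ cong (λ r → + (pj %ℕ suc β) +ℤ pj /ℕ suc β *ℤ b - (+ r +ℤ pi /ℕ suc β *ℤ b)) same ⟩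
      + (pj %ℕ suc β) +ℤ pj /ℕ suc β *ℤ b - (+ (pj %ℕ suc β) +ℤ pi /ℕ suc β *ℤ b)
        ≡⟨ lemma (+ (pj %ℕ suc β)) (pj /ℕ suc β) (pi /ℕ suc β) b ⟩
      (pj /ℕ suc β - pi /ℕ suc β) *ℤ b ∎)
      where
      open ≡-Reasoning
      pi pj : ℤ
      pi = p (toℕ i)
      pj = p (toℕ j)
      same : pi %ℕ suc β ≡ pj %ℕ suc β
      same = trans (sym (Fin.toℕ-fromℕ< (n%ℕd<d pi (suc β))))
        (trans (cong toℕ ri≡rj) (Fin.toℕ-fromℕ< (n%ℕd<d pj (suc β))))
      lemma : ∀ r x y b → r +ℤ x *ℤ b - (r +ℤ y *ℤ b) ≡ (x - y) *ℤ b
      lemma = solve-∀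

  -- Two of the b + 1 partial sums `p 0`, ..., `p b` agree modulo b, so the block of summands
  -- between them can be cut out. The record that `q *ℤ b` is itself a sum of elements of `B` later
  -- determines the sign of `q`.
  shorten : ∀ h {n} → β ℕ.< h → n ∈ h · B →
    ∃[ k ] k ℕ.< h × ∃[ s ] s ∈ k · B × ∃[ q ] ⋃· B (q *ℤ b) × n ≡ s +ℤ q *ℤ b
  shorten h {n} β<h n∈ with partialSums h n∈
  ... | p , p0≡0 , ph≡n , steps with repeatedResidue p
  ...   | i , j , i<j , j≤b , q , pj-pi≡qb =
    i ℕ.+ (h ℕ.∸ j) , k<h , s , s∈ , q , (j ℕ.∸ i , qb∈) , n≡
    where
    j≤h : j ℕ.≤ h
    j≤h = ℕ.≤-trans j≤b β<h
    -- What remains are the first `i` and the last `h - j` summands.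
    s : ℤ
    s = p i - p 0 +ℤ (p h - p j)
    block : ∀ {i j} → i ℕ.≤ j → p j - p i ∈ (j ℕ.∸ i) · B
    block {i} {j} i≤j = subst (λ l → p l - p i ∈ (j ℕ.∸ i) · B) (ℕ.m+[n∸m]≡n i≤j) (steps i (j ℕ.∸ i))
    k<h : i ℕ.+ (h ℕ.∸ j) ℕ.< h
    k<h = subst (i ℕ.+ (h ℕ.∸ j) ℕ.<_) (ℕ.m+[n∸m]≡n j≤h) (ℕ.+-monoˡ-< (h ℕ.∸ j) i<j)
    s∈ : s ∈ (i ℕ.+ (h ℕ.∸ j)) · B
    s∈ = ·-+ i (h ℕ.∸ j) (block {0} {i} ℕ.z≤n) (block j≤h)
    qb∈ : q *ℤ b ∈ (j ℕ.∸ i) · B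
    qb∈ = subst (_∈ (j ℕ.∸ i) · B) pj-pi≡qb (block (ℕ.<⇒≤ i<j))
    lemma : ∀ x y z w → x - w ≡ y - w +ℤ (x - z) +ℤ (z - y)
    lemma = solve-∀
    n≡ : n ≡ s +ℤ q *ℤ b
    n≡ = begin
      n                        ≡⟨ ph≡n ⟨
      p h                      ≡⟨ ℤ.+-identityʳ (p h) ⟨
      p h - 0ℤ                 ≡⟨ cong (λ z → p h - z) p0≡0 ⟨
      p h - p 0                ≡⟨ lemma (p h) (p i) (p j) (p 0) ⟩
      s +ℤ (p j - p i)         ≡⟨ cong (s +ℤ_) pj-pi≡qb ⟩
      s +ℤ q *ℤ b              ∎
      where open ≡-Reasoning

  -- `shorten` is iterated until at most `β` summands remain. A block may have any positive length,
  -- whence the well-founded recursion on `h`.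
  reduce : ∀ h {n} → n ∈ h · B →
    ∃[ s ] s ∈ β · B × ∃[ q ] ⋃· B (q *ℤ b) × n ≡ s +ℤ q *ℤ b
  reduce = <-rec _ step
    where
    step : ∀ h → (∀ {k} → k ℕ.< h → ∀ {n} → n ∈ k · B → ∃[ s ] s ∈ β · B × ∃[ q ] ⋃· B (q *ℤ b) × n ≡ s +ℤ q *ℤ b) →
      ∀ {n} → n ∈ h · B → ∃[ s ] s ∈ β · B × ∃[ q ] ⋃· B (q *ℤ b) × n ≡ s +ℤ q *ℤ b
    step h rec {n} n∈ with h ℕ.≤? β
    -- Zeros pad the sum to exactly `β` summands.
    ... | yes h≤β = n , ·-mono-≤ 0∈B h≤β n∈ , 0ℤ , (0 , here refl) , sym (ℤ.+-identityʳ n)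
    ... | no h≰β with shorten h (ℕ.≰⇒> h≰β) n∈
    ...   | k , k<h , s , s∈ , q , (c , qb∈) , refl with rec k<h s∈
    ...     | s′ , s′∈ , q′ , (c′ , q′b∈) , refl =
      s′ , s′∈ , q′ +ℤ q , (c′ ℕ.+ c , subst (_∈ (c′ ℕ.+ c) · B) (sym (ℤ.*-distribʳ-+ b q′ q)) (·-+ c′ c q′b∈ qb∈))
      , lemma s′ q′ q b
      where
      lemma : ∀ s q′ q b → s +ℤ q′ *ℤ b +ℤ q *ℤ b ≡ s +ℤ (q′ +ℤ q) *ℤ b
      lemma = solve-∀

  -- The preimage in ℤ of the submonoid of ℤ/b generated by `B`. As ℤ/b is finite, it is a subgroup
  -- of ℤ, hence closed under gcd.
  Reached : Pred ℤ 0ℓ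
  Reached n = ∃[ m ] ⋃· B m × ∃[ q ] n ≡ m +ℤ q *ℤ b

  reached-+ : ∀ {m n} → Reached m → Reached n → Reached (m +ℤ n)
  reached-+ (m , (h , m∈) , q , refl) (n , (k , n∈) , r , refl) =
    m +ℤ n , (h ℕ.+ k , ·-+ h k m∈ n∈) , q +ℤ r , lemma m n q r b
    where
    lemma : ∀ m n q r b → m +ℤ q *ℤ b +ℤ (n +ℤ r *ℤ b) ≡ m +ℤ n +ℤ (q +ℤ r) *ℤ b
    lemma = solve-∀

  reached-0 : Reached 0ℤ
  reached-0 = 0ℤ , (0 , here refl) , 0ℤ , refl

  reached-ℕ* : ∀ k {n} → Reached n → Reached (+ k *ℤ n)
  reached-ℕ* zero    Rn = reached-0
  reached-ℕ* (suc k) {n} Rn = subst Reached (lemma (+ k) n) (reached-+ Rn (reached-ℕ* k Rn))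
    where
    lemma : ∀ k n → n +ℤ k *ℤ n ≡ (1ℤ +ℤ k) *ℤ n
    lemma = solve-∀

  reached-multiple : ∀ q → Reached (q *ℤ b)
  reached-multiple q = 0ℤ , (0 , here refl) , q , sym (ℤ.+-identityˡ (q *ℤ b))

  -- Modulo b, multiplication by -1 is multiplication by b - 1.
  reached-neg : ∀ {n} → Reached n → Reached (- n)
  reached-neg {n} Rn = subst Reached (lemma n (+ β)) (reached-+ (reached-ℕ* β Rn) (reached-multiple (- n)))
    where
    lemma : ∀ n β → β *ℤ n +ℤ (- n) *ℤ (1ℤ +ℤ β) ≡ - n
    lemma = solve-∀

  reached-∣∣ : ∀ n → Reached n → Reached (+ ∣ n ∣)
  reached-∣∣ (+ n)    Rn = Rn
  reached-∣∣ -[1+ n ] Rn = reached-neg Rn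

  -- The hypothesis has the subtraction-free form in which Bézout's identity is given for natural
  -- numbers.
  reached-combination : ∀ {d} x m y n → d ℕ.+ y ℕ.* n ≡ x ℕ.* m →
    Reached (+ m) → Reached (+ n) → Reached (+ d)
  reached-combination {d} x m y n eq Rm Rn = subst Reached xm-yn≡d
    (reached-+ (reached-ℕ* x Rm) (reached-neg (reached-ℕ* y Rn)))
    where
    open ≡-Reasoning
    lemma : ∀ d z → d +ℤ z - z ≡ d
    lemma = solve-∀
    xm-yn≡d : + x *ℤ + m - + y *ℤ + n ≡ + d
    xm-yn≡d = begin
      + x *ℤ + m - + y *ℤ + n            ≡⟨ cong₂ _-_ (ℤ.pos-* x m) (ℤ.pos-* y n) ⟨
      + (x ℕ.* m) - + (y ℕ.* n)          ≡⟨ cong (λ z → + z - + (y ℕ.* n)) eq ⟨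
      + d +ℤ + (y ℕ.* n) - + (y ℕ.* n)   ≡⟨ lemma (+ d) (+ (y ℕ.* n)) ⟩
      + d                                ∎

  reached-gcd : ∀ m n → Reached (+ m) → Reached (+ n) → Reached (+ ℕ.gcd m n)
  reached-gcd m n Rm Rn with ℕ.Bézout.identity (ℕ.gcd-GCD m n)
  ... | ℕ.Bézout.+- x y eq = reached-combination x m y n eq Rm Rn
  ... | ℕ.Bézout.-+ x y eq = reached-combination y n x m eq Rn Rm

  reached-setGcd : ∀ {L} → All Reached L → Reached (setGcd L)
  reached-setGcd []       = reached-0
  reached-setGcd {n ∷ L} (Rn ∷ RL) =
    reached-gcd ∣ n ∣ ∣ setGcd L ∣ (reached-∣∣ n Rn) (reached-∣∣ (setGcd L) (reached-setGcd RL))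

  -- The subgroup `Reached` contains `B`, hence gcd B = 1, hence every integer; `reduce` then brings
  -- the representative to `β` summands.
  allResidues : setGcd B ≡ 1ℤ → ∀ n → ∃[ s ] s ∈ β · B × ∃[ q ] n ≡ s +ℤ q *ℤ b
  allResidues gcd≡1 n with reached n
    where
    reached-∈ : ∀ {i} → i ∈ B → Reached i
    reached-∈ {i} i∈ = i , (1 , subst (_∈ 1 · B) (ℤ.*-identityˡ i) (·-multiple 1 i∈)) , 0ℤ , sym (ℤ.+-identityʳ i)
    reached-+ve : ∀ k → Reached (+ k)
    reached-+ve k = subst Reached (ℤ.*-identityʳ (+ k))
      (reached-ℕ* k (subst Reached gcd≡1 (reached-setGcd (All.tabulate reached-∈))))
    reached : ∀ n → Reached n
    reached (+ k)    = reached-+ve k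
    reached -[1+ k ] = reached-neg (reached-+ve (suc k))
  ... | m , (h , m∈) , q , refl with reduce h m∈
  ...   | s , s∈ , q′ , _ , refl = s , s∈ , q′ +ℤ q , lemma s q′ q b
    where
    lemma : ∀ s q′ q b → s +ℤ q′ *ℤ b +ℤ q *ℤ b ≡ s +ℤ (q′ +ℤ q) *ℤ b
    lemma = solve-∀

-- Membership in hA, T₀ and T_b

i≤i+j⇒0≤j : ∀ i j → i ≤ i +ℤ j → 0ℤ ≤ j
i≤i+j⇒0≤j i j i≤i+j = subst (0ℤ ≤_) (lemma i j) (ℤ.i≤j⇒0≤j-i i≤i+j)
  where
  lemma : ∀ i j → i +ℤ j - i ≡ j
  lemma = solve-∀

module Extremes (A : List ℤ) (β : ℕ)
  (0-min : IsMin A 0ℤ) (b-max : IsMax A (+ suc β)) (gcd≡1 : setGcd A ≡ 1ℤ) where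

  private
    b : ℤ
    b = + suc β

    0∈A : 0ℤ ∈ A
    0∈A = proj₁ 0-min

    b∈A : b ∈ A
    b∈A = proj₁ b-max

    0∈A-b : 0ℤ ∈ translate A b
    0∈A-b = subst (_∈ translate A b) (ℤ.+-inverseʳ b) (∈-map⁺ (_- b) b∈A)

    -b∈A-b : 0ℤ - b ∈ translate A b
    -b∈A-b = ∈-map⁺ (_- b) 0∈A

    module R₀ = Reduction {A} 0∈A β
    module R∞ = Reduction {translate A b} 0∈A-b β

  0≤·A : ∀ h {n} → n ∈ h · A → 0ℤ ≤ n
  0≤·A = ·-closed ℤ.≤-refl ℤ.+-mono-≤ (proj₂ 0-min)

  ·[A-b]≤0 : ∀ h {n} → n ∈ h · translate A b → n ≤ 0ℤ
  ·[A-b]≤0 = ·-closed ℤ.≤-refl ℤ.+-mono-≤ (All.map⁺ (All.map ℤ.i≤j⇒i-j≤0 (proj₂ b-max)))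

  ·A≤hb : ∀ h {n} → n ∈ h · A → n ≤ + h *ℤ b
  ·A≤hb h {n} n∈ = subst (_≤ + h *ℤ b) (lemma n (+ h *ℤ b))
    (subst (n - + h *ℤ b +ℤ + h *ℤ b ≤_) (ℤ.+-identityˡ _)
      (ℤ.+-monoˡ-≤ (+ h *ℤ b) (·[A-b]≤0 h (·-translate⁺ b h n∈))))
    where
    lemma : ∀ n z → n - z +ℤ z ≡ n
    lemma = solve-∀

  ·A⇒T₀ : ∀ h {n} → n ∈ h · A → T A 0ℤ n
  ·A⇒T₀ h {n} n∈ = h , subst (_∈ h · translate A 0ℤ) (lemma n (+ h)) (·-translate⁺ 0ℤ h n∈)
    where
    lemma : ∀ n h → n - h *ℤ 0ℤ ≡ n
    lemma = solve-∀

  T₀⇒·A : ∀ {n} → T A 0ℤ n → ⋃· A n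
  T₀⇒·A {n} (h , n∈) = h , subst (_∈ h · A) (lemma n (+ h)) (·-translate⁻ 0ℤ h n∈)
    where
    lemma : ∀ n h → n +ℤ h *ℤ 0ℤ ≡ n
    lemma = solve-∀

  T₀-nonNeg : ∀ {n} → T A 0ℤ n → 0ℤ ≤ n
  T₀-nonNeg n∈ with T₀⇒·A n∈
  ... | h , n∈hA = 0≤·A h n∈hA

  T-b-nonPos : ∀ {n} → T A b n → n ≤ 0ℤ
  T-b-nonPos (h , n∈) = ·[A-b]≤0 h n∈

  +multiple∈ : ∀ {s} k → s ∈ β · A → s +ℤ + k *ℤ b ∈ (β ℕ.+ k) · A
  +multiple∈ k s∈ = ·-+ β k s∈ (·-multiple k b∈A)

  -- Each of the `β` summands of `s` loses b under translation, and `k` copies of -b are added.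
  -multiple∈T-b : ∀ {s} k → s ∈ β · A → T A b (s - + (β ℕ.+ k) *ℤ b)
  -multiple∈T-b {s} k s∈ = β ℕ.+ k , subst (_∈ (β ℕ.+ k) · translate A b) (lemma s (+ β) (+ k) b)
    (·-+ β k (·-translate⁺ b β s∈) (·-multiple k -b∈A-b))
    where
    lemma : ∀ s β k b → s - β *ℤ b +ℤ k *ℤ (0ℤ - b) ≡ s - (β +ℤ k) *ℤ b
    lemma = solve-∀

  nonNegQuotient : ∀ q → 0ℤ ≤ q *ℤ b → ∃[ j ] q ≡ + j
  nonNegQuotient (+ j)    _ = j , refl
  nonNegQuotient -[1+ _ ] ()

  nonPosQuotient : ∀ q → q *ℤ b ≤ 0ℤ → ∃[ i ] q ≡ - + i
  nonPosQuotient (+ zero)  _        = 0 , refl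
  nonPosQuotient (+ suc _) (+≤+ ())
  nonPosQuotient -[1+ i ]  _        = suc i , refl

  -- The representative satisfies s ≤ βb ≤ n, so the quotient is nonnegative and counts extra
  -- summands b.
  T₀-large : ∀ n → + (β ℕ.* suc β) ≤ n → T A 0ℤ n
  T₀-large n βb≤n with R₀.allResidues gcd≡1 n
  ... | s , s∈ , q , refl with nonNegQuotient q (i≤i+j⇒0≤j s (q *ℤ b) (begin
        s                  ≤⟨ ·A≤hb β s∈ ⟩
        + β *ℤ b           ≡⟨ ℤ.pos-* β (suc β) ⟨
        + (β ℕ.* suc β)    ≤⟨ βb≤n ⟩
        s +ℤ q *ℤ b        ∎))
    where open ℤ.≤-Reasoning
  ...   | j , refl = ·A⇒T₀ (β ℕ.+ j) (+multiple∈ j s∈)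

  T-b-small : ∀ n → n ≤ - + (β ℕ.* suc β) → T A b n
  -- Translating the `β` summands of `s` costs βb, so the representative is taken for n + βb. As n +
  -- βb ≤ 0 ≤ s, the quotient is nonpositive.
  T-b-small n n≤-βb with R₀.allResidues gcd≡1 (n +ℤ + β *ℤ b)
  ... | s , s∈ , q , n+βb≡ with nonPosQuotient q (ℤ.≤-trans (ℤ.i≤j+i (q *ℤ b) s {{nonNegative (0≤·A β s∈)}}) (begin
        s +ℤ q *ℤ b                         ≡⟨ n+βb≡ ⟨
        n +ℤ + β *ℤ b                       ≡⟨ cong (n +ℤ_) (ℤ.pos-* β (suc β)) ⟨
        n +ℤ + (β ℕ.* suc β)                ≤⟨ ℤ.+-monoˡ-≤ (+ (β ℕ.* suc β)) n≤-βb ⟩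
        - + (β ℕ.* suc β) +ℤ + (β ℕ.* suc β) ≡⟨ ℤ.+-inverseˡ (+ (β ℕ.* suc β)) ⟩
        0ℤ                                  ∎))
    where open ℤ.≤-Reasoning
  ...   | i , refl = subst (T A b) (begin
        s - + (β ℕ.+ i) *ℤ b                    ≡⟨ lemma s (+ β) (+ i) b ⟩
        s +ℤ - + i *ℤ b - + β *ℤ b              ≡⟨ cong (_- + β *ℤ b) n+βb≡ ⟨
        n +ℤ + β *ℤ b - + β *ℤ b                ≡⟨ lemma′ n (+ β *ℤ b) ⟩
        n                                       ∎)
      (-multiple∈T-b i s∈)
    where
    open ≡-Reasoning
    lemma : ∀ s β i b → s - (β +ℤ i) *ℤ b ≡ s +ℤ - i *ℤ b - β *ℤ b
    lemma = solve-∀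
    lemma′ : ∀ n z → n +ℤ z - z ≡ n
    lemma′ = solve-∀

  -- The bound is h ≥ 2b - 4 with b = β + 1, freed of subtraction.
  module _ (h : ℕ) (2β≤h+2 : β ℕ.+ β ℕ.≤ h ℕ.+ 2) where

    ·A⇒T₀×T-b : ∀ {n} → n ∈ h · A → T A 0ℤ n × T A b (n - + h *ℤ b)
    ·A⇒T₀×T-b n∈ = ·A⇒T₀ h n∈ , h , ·-translate⁺ b h n∈

    T₀×T-b⇒·A : ∀ {n} → T A 0ℤ n → T A b (n - + h *ℤ b) → n ∈ h · A
    T₀×T-b⇒·A {n} n∈T₀ (k′ , n-hb∈) with T₀⇒·A n∈T₀
    ... | k , n∈ with R₀.reduce k n∈ | R∞.reduce k′ n-hb∈
    ...   | s , s∈ , q , (c , qb∈) , n≡ | s′ , s′∈ , q′ , (c′ , q′b∈) , n-hb≡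
      -- The multiples of b that were cut out are sums of elements of `A` and of A - b respectively,
      -- which fixes their signs.
      with nonNegQuotient q (0≤·A c qb∈) | nonPosQuotient q′ (·[A-b]≤0 c′ q′b∈)
    ...     | j , refl | i , refl with β ℕ.+ j ℕ.≤? h | β ℕ.+ i ℕ.≤? h
    ...       | yes β+j≤h | _ =
      ·-mono-≤ 0∈A β+j≤h (subst (_∈ (β ℕ.+ j) · A) (sym n≡) (+multiple∈ j s∈))
    -- Here n - hb is a sum of `β` elements of A - b, `i` copies of -b and `d` copies of 0. Adding b
    -- to each of these `h` summands turns the copies of -b into 0 and those of 0 into b.
    ...       | no _ | yes β+i≤h =
      ·-mono-≤ 0∈A β+d≤h (subst (_∈ (β ℕ.+ d) · A) t+db≡n (+multiple∈ d (·-translate⁻ b β s′∈)))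
      where
      d : ℕ
      d = h ℕ.∸ (β ℕ.+ i)
      h≡ : β ℕ.+ i ℕ.+ d ≡ h
      h≡ = ℕ.m+[n∸m]≡n β+i≤h
      β+d≤h : β ℕ.+ d ℕ.≤ h
      β+d≤h = subst (β ℕ.+ d ℕ.≤_) h≡ (ℕ.+-monoˡ-≤ d (ℕ.m≤m+n β i))
      lemma : ∀ s β i d b → s +ℤ β *ℤ b +ℤ d *ℤ b ≡ s +ℤ - i *ℤ b +ℤ (β +ℤ i +ℤ d) *ℤ b
      lemma = solve-∀
      lemma′ : ∀ n z → n - z +ℤ z ≡ n
      lemma′ = solve-∀
      t+db≡n : s′ +ℤ + β *ℤ b +ℤ + d *ℤ b ≡ n
      t+db≡n = begin
        s′ +ℤ + β *ℤ b +ℤ + d *ℤ b                      ≡⟨ lemma s′ (+ β) (+ i) (+ d) b ⟩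
        s′ +ℤ - + i *ℤ b +ℤ + (β ℕ.+ i ℕ.+ d) *ℤ b      ≡⟨ cong₂ (λ z l → z +ℤ + l *ℤ b) (sym n-hb≡) h≡ ⟩
        n - + h *ℤ b +ℤ + h *ℤ b                        ≡⟨ lemma′ n (+ h *ℤ b) ⟩
        n                                               ∎
        where open ≡-Reasoning
    ...       | no β+j≰h | no β+i≰h =
      ·-mono-≤ 0∈A j≤h (subst (_∈ j · A) jb≡n (·-multiple j b∈A))
      where
      0≤s : 0ℤ ≤ s
      0≤s = 0≤·A β s∈
      s′≤0 : s′ ≤ 0ℤ
      s′≤0 = ·[A-b]≤0 β s′∈

      h≤j+i : h ℕ.≤ j ℕ.+ i
      -- From h + 1 ≤ β + j and h + 1 ≤ β + i follows 2h + 2 ≤ 2β + j + i ≤ h + 2 + j + i.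
      h≤j+i = ℕ.+-cancelˡ-≤ (h ℕ.+ 2) h (j ℕ.+ i) (begin
        h ℕ.+ 2 ℕ.+ h                     ≡⟨ regroup₁ h ⟩
        suc h ℕ.+ suc h                   ≤⟨ ℕ.+-mono-≤ (ℕ.≰⇒> β+j≰h) (ℕ.≰⇒> β+i≰h) ⟩
        (β ℕ.+ j) ℕ.+ (β ℕ.+ i)           ≡⟨ regroup₂ β j i ⟩
        (β ℕ.+ β) ℕ.+ (j ℕ.+ i)           ≤⟨ ℕ.+-monoˡ-≤ (j ℕ.+ i) 2β≤h+2 ⟩
        h ℕ.+ 2 ℕ.+ (j ℕ.+ i)             ∎)
        where
        open ℕ.≤-Reasoning
        regroup₁ : ∀ h → h ℕ.+ 2 ℕ.+ h ≡ suc h ℕ.+ suc h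
        regroup₁ = ℕ-solve-∀
        regroup₂ : ∀ β j i → (β ℕ.+ j) ℕ.+ (β ℕ.+ i) ≡ (β ℕ.+ β) ℕ.+ (j ℕ.+ i)
        regroup₂ = ℕ-solve-∀

      -- Eliminates n from n = s + jb and n - hb = s′ - ib. Since s ≥ 0 ≥ s′, this bounds j + i by
      -- h; once j + i = h it gives s = s′, so both vanish.
      balance : s +ℤ + (j ℕ.+ i) *ℤ b ≡ s′ +ℤ + h *ℤ b
      balance = begin
        s +ℤ + (j ℕ.+ i) *ℤ b                                     ≡⟨ lemma s (+ j) (+ i) (+ h) b ⟩
        (s +ℤ + j *ℤ b) - + h *ℤ b +ℤ (+ i *ℤ b +ℤ + h *ℤ b)      ≡⟨ cong (λ z → z - + h *ℤ b +ℤ (+ i *ℤ b +ℤ + h *ℤ b)) n≡ ⟨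
        n - + h *ℤ b +ℤ (+ i *ℤ b +ℤ + h *ℤ b)                    ≡⟨ cong (_+ℤ (+ i *ℤ b +ℤ + h *ℤ b)) n-hb≡ ⟩
        s′ +ℤ - + i *ℤ b +ℤ (+ i *ℤ b +ℤ + h *ℤ b)                ≡⟨ lemma′ s′ (+ i) (+ h) b ⟩
        s′ +ℤ + h *ℤ b                                            ∎
        where
        open ≡-Reasoning
        lemma : ∀ s j i h b → s +ℤ (j +ℤ i) *ℤ b ≡ (s +ℤ j *ℤ b) - h *ℤ b +ℤ (i *ℤ b +ℤ h *ℤ b)
        lemma = solve-∀
        lemma′ : ∀ s i h b → s +ℤ - i *ℤ b +ℤ (i *ℤ b +ℤ h *ℤ b) ≡ s +ℤ h *ℤ b
        lemma′ = solve-∀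

      j+i≤h : j ℕ.+ i ℕ.≤ h
      j+i≤h = ℤ.drop‿+≤+ (ℤ.*-cancelʳ-≤-pos (+ (j ℕ.+ i)) (+ h) b (begin
        + (j ℕ.+ i) *ℤ b          ≡⟨ ℤ.+-identityˡ _ ⟨
        0ℤ +ℤ + (j ℕ.+ i) *ℤ b    ≤⟨ ℤ.+-monoˡ-≤ (+ (j ℕ.+ i) *ℤ b) 0≤s ⟩
        s +ℤ + (j ℕ.+ i) *ℤ b     ≡⟨ balance ⟩
        s′ +ℤ + h *ℤ b            ≤⟨ ℤ.+-monoˡ-≤ (+ h *ℤ b) s′≤0 ⟩
        0ℤ +ℤ + h *ℤ b            ≡⟨ ℤ.+-identityˡ _ ⟩
        + h *ℤ b                  ∎))
        where open ℤ.≤-Reasoning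

      j≤h : j ℕ.≤ h
      j≤h = ℕ.≤-trans (ℕ.m≤m+n j i) j+i≤h

      s≡0 : s ≡ 0ℤ
      s≡0 = ℤ.≤-antisym (ℤ.≤-trans (ℤ.≤-reflexive s≡s′) s′≤0) 0≤s
        where
        s≡s′ : s ≡ s′
        s≡s′ = +-cancelʳ (+ h *ℤ b) s s′
          (trans (cong (λ l → s +ℤ + l *ℤ b) (ℕ.≤-antisym h≤j+i j+i≤h)) balance)

      jb≡n : + j *ℤ b ≡ n
      jb≡n = trans (sym (ℤ.+-identityˡ _)) (trans (cong (_+ℤ + j *ℤ b) (sym s≡0)) (sym n≡))

    -- The sign of the quotient of n by b, relative to a representative `s` with `β` summands,
    -- decides between the two sets.
    T₀⊎T-b : ∀ n → T A 0ℤ n ⊎ T A b (n - + h *ℤ b)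
    T₀⊎T-b n with R₀.allResidues gcd≡1 n
    ... | s , s∈ , + j      , refl = inj₁ (·A⇒T₀ (β ℕ.+ j) (+multiple∈ j s∈))
    ... | s , s∈ , -[1+ i ] , refl = inj₂ (subst (T A b) (begin
        s - + (β ℕ.+ d) *ℤ b                       ≡⟨ cong (λ l → s - + l *ℤ b) (ℕ.m+[n∸m]≡n β≤) ⟩
        s - + (suc i ℕ.+ h) *ℤ b                   ≡⟨ lemma s (+ suc i) (+ h) b ⟩
        s +ℤ -[1+ i ] *ℤ b - + h *ℤ b              ∎)
      (-multiple∈T-b d s∈))
      where
      open ≡-Reasoning
      d : ℕ
      -- The truncated subtraction is exact because β ≤ h + 1: otherwise 2h + 4 ≤ 2β ≤ h + 2.
      d = suc i ℕ.+ h ℕ.∸ β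
      lemma : ∀ s i h b → s - (i +ℤ h) *ℤ b ≡ s +ℤ - i *ℤ b - h *ℤ b
      lemma = solve-∀
      β≤1+h : β ℕ.≤ suc h
      β≤1+h = ℕ.≮⇒≥ λ 1+h<β → ℕ.<⇒≱ (ℕ.m<m+n (h ℕ.+ 2) (ℕ.s≤s ℕ.z≤n))
        (ℕ.≤-trans (ℕ.≤-trans (ℕ.≤-reflexive (regroup h)) (ℕ.+-mono-≤ 1+h<β 1+h<β)) 2β≤h+2)
        where
        regroup : ∀ h → h ℕ.+ 2 ℕ.+ suc (suc h) ≡ suc (suc h) ℕ.+ suc (suc h)
        regroup = ℕ-solve-∀
      β≤ : β ℕ.≤ suc i ℕ.+ h
      β≤ = ℕ.≤-trans β≤1+h (ℕ.s≤s (ℕ.m≤n+m h i))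

-- Indicator series and the identity

genSeries-∈ : ∀ {S : Pred ℤ 0ℓ} (S? : Decidable S) {n} → S n → genSeries S? n ≡ 1ℤ
genSeries-∈ S? {n} Sn rewrite dec-true (S? n) Sn = refl

genSeries-∉ : ∀ {S : Pred ℤ 0ℓ} (S? : Decidable S) {n} → ¬ S n → genSeries S? n ≡ 0ℤ
genSeries-∉ S? {n} ¬Sn rewrite dec-false (S? n) ¬Sn = refl

-- Inclusion-exclusion: `is` enumerates the intersection, and the union is everything. Two points
-- `m` and `n` occur because the second series is shifted.
genSeries-+ : ∀ {S R : Pred ℤ 0ℓ} (S? : Decidable S) (R? : Decidable R) {is} → Unique is →
  ∀ {m n} → (m ∈ is → S m × R n) → (S m → R n → m ∈ is) → S m ⊎ R n →
  genSeries S? m +ℤ genSeries R? n ≡ multiplicity is m +ℤ 1ℤ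
genSeries-+ S? R? {is} unique {m} {n} to from cover with S? m | R? n
... | yes Sm | yes Rn = cong (_+ℤ 1ℤ) (sym (multiplicity-∈ unique (from Sm Rn)))
... | yes _  | no ¬Rn = cong (_+ℤ 1ℤ) (sym (multiplicity-∉ is (¬Rn ∘ proj₂ ∘ to)))
... | no ¬Sm | yes _  = cong (_+ℤ 1ℤ) (sym (multiplicity-∉ is (¬Sm ∘ proj₁ ∘ to)))
... | no ¬Sm | no ¬Rn = contradiction cover [ ¬Sm , ¬Rn ]′

-- Rules out b = 0, where every entry of A would be 0, against gcd A = 1.
setGcd-zeros : ∀ {A} → All (_≡ 0ℤ) A → setGcd A ≡ 0ℤ
setGcd-zeros [] = refl
setGcd-zeros (refl ∷ A≡0) rewrite setGcd-zeros A≡0 = refl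

theorem5p1 : (A : List ℤ) (b : ℤ) (min : IsMin A 0ℤ) (max : IsMax A b) →
    setGcd A ≡ 1ℤ →
    ∃[ R₀ ] ∃[ R∞ ]
    R₀ ExpandsAt0To σ A 0ℤ (inj₁ min) ×
    R∞ ExpandsAt∞To σ A b (inj₂ max) ×
    ((h : ℕ) → + 2 *ℤ b - + 4 ≤ + h →
    σ-finite (h · A) ≈ R₀ + x^ (+ h *ℤ b) * R∞)
theorem5p1 A -[1+ _ ] min max gcd≡1 with All.lookup (proj₂ max) (proj₁ min)
... | ()
theorem5p1 A (+ zero) min max gcd≡1 = contradiction
  (trans (sym gcd≡1) (setGcd-zeros (All.zipWith (λ (0≤i , i≤0) → ℤ.≤-antisym i≤0 0≤i) (proj₂ min , proj₂ max))))
  1≢0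
theorem5p1 A (+ suc β) min max gcd≡1 = R₀ , R∞ , proj₂ rational₀ , proj₂ rational∞ , identity
  where
  open Extremes A β min max gcd≡1

  b : ℤ
  b = + suc β
  -- The bound (b - 1)b on sums of b - 1 elements of A: T₀ contains every n ≥ `N`, and T_b every n ≤
  -- -`N`.
  N : ℕ
  N = β ℕ.* suc β
  T₀? : Decidable (T A 0ℤ)
  T₀? = T? A 0ℤ (inj₁ min)
  T-b? : Decidable (T A b)
  T-b? = T? A b (inj₂ max)

  rational₀ : ∃[ p ] (p / 1-x ⟨ 1-x-nonZero ⟩) ExpandsAt0To genSeries T₀?
  rational₀ = eventuallyConstant⇒rational₀ N
    (λ n n<0 → genSeries-∉ T₀? (ℤ.<⇒≱ n<0 ∘ T₀-nonNeg))
    (λ n N≤n → genSeries-∈ T₀? (T₀-large n N≤n))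

  rational∞ : ∃[ p ] (p / monomial N *ₚ 1-x ⟨ monomial*1-x-nonZero N ⟩) ExpandsAt∞To genSeries T-b?
  rational∞ = eventuallyConstant⇒rational∞ N
    (λ n 0<n → genSeries-∉ T-b? (ℤ.<⇒≱ 0<n ∘ T-b-nonPos))
    (λ n n≤-N → genSeries-∈ T-b? (T-b-small n n≤-N))

  R₀ R∞ : RatFun
  R₀ = proj₁ rational₀ / 1-x ⟨ 1-x-nonZero ⟩
  R∞ = proj₁ rational∞ / monomial N *ₚ 1-x ⟨ monomial*1-x-nonZero N ⟩

  identity : (h : ℕ) → + 2 *ℤ b - + 4 ≤ + h → σ-finite (h · A) ≈ R₀ + x^ (+ h *ℤ b) * R∞
  -- The exponent is rewritten as the image of a natural number, on which `x^_` computes. Both sides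
  -- then represent `multiplicity distinct`.
  identity h 2b-4≤h = subst (λ m → σ-finite (h · A) ≈ R₀ + x^ m * R∞) (ℤ.pos-* h (suc β))
    (represents-unique {σ-finite (h · A)} {R₀ + x^hb*R∞} (σ-finite-represents (h · A)) R₀+x^hb*R∞-represents)
    where
    distinct : List ℤ
    distinct = deduplicate _≟ℤ_ (h · A)

    x^hb*R∞ : RatFun
    x^hb*R∞ = x^ (+ (h ℕ.* suc β)) * R∞

    2β≤h+2 : β ℕ.+ β ℕ.≤ h ℕ.+ 2
    2β≤h+2 = ℤ.drop‿+≤+ (subst (_≤ + (h ℕ.+ 2)) (lemma (+ β)) (ℤ.+-monoˡ-≤ (+ 2) 2b-4≤h))
      where
      lemma : ∀ β → + 2 *ℤ (1ℤ +ℤ β) - + 4 +ℤ + 2 ≡ β +ℤ β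
      lemma = solve-∀

    indicators : genSeries T₀? ⊕ shift (+ (h ℕ.* suc β)) (genSeries T-b?) ≗ˢ multiplicity distinct ⊕ (λ _ → 1ℤ)
    indicators n = trans (cong (λ m → genSeries T₀? n +ℤ genSeries T-b? (n - m)) (ℤ.pos-* h (suc β)))
      (genSeries-+ T₀? T-b? (deduplicate-! (h · A))
        (·A⇒T₀×T-b h 2β≤h+2 ∘ ∈-deduplicate⁻ _≟ℤ_ (h · A))
        (λ n∈T₀ n∈T-b → ∈-deduplicate⁺ _≟ℤ_ (T₀×T-b⇒·A h 2β≤h+2 n∈T₀ n∈T-b))
        (T₀⊎T-b h 2β≤h+2 n))

    R₀+x^hb*R∞-represents : R₀ + x^hb*R∞ Represents multiplicity distinct
    -- By `indicators` the two expansions add up to `multiplicity distinct` plus the constant series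
    -- 1, which the factor `1-x` of the denominator annihilates.
    R₀+x^hb*R∞-represents = represents-torsion {R₀ + x^hb*R∞} (1-x-torsion (den x^hb*R∞))
      (represents-cong {R₀ + x^hb*R∞} indicators
        (+-represents {R₀} {x^hb*R∞} {genSeries T₀?} (proj₂ (proj₂ rational₀))
          (x^*-represents (h ℕ.* suc β) {R∞} {genSeries T-b?} (proj₂ (proj₂ rational∞)))))
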